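{- There exists a function $\varepsilon:\mathbb{N}\to[0,\infty)$ with $\varepsilon(m)\to 0$ as $m\to\infty$ such that the following holds. Let $A$ and $B$ be disjoint finite sets with $|A|=a$ and $|B|=b$, let $K_{A,B}$ denote the complete bipartite graph with color classes $A$ and $B$, and let $D$ be a bipartite demand graph on $A\cup B$ with color classes $A$ and $B$ (i.e., every edge of $D$ joins a vertex of $A$ to a vertex of $B$). If $d_D(x)\le (1-\varepsilon(b))\,b/4$ for all $x\in A$ and $d_D(y)\le (1-\varepsilon(a))\,a/4$ for all $y\in B$, then $D$ is resolvable in $K_{A,B}$.
   Context: A demand graph on the vertex set of a simple base graph $G$ is a loopless multigraph $D$ with $V(D)=V(G)$ (parallel edges allowed). $D$ is resolvable in $G$ if one can assign to each edge of $D$ (counted with multiplicity) a path in $G$ joining the two endpoints of that edge, such that the assigned paths are pairwise edge-disjoint. Degrees $d_D$ count edges with multiplicity. The paper states the degree bounds as $(1-o(1))b/4$ and $(1-o(1))a/4$; the function $\varepsilon$ formalizes this $o(1)$ term. -}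

module Defs where

open import Data.Nat using (ℕ; zero; suc; _+_)
open import Data.Fin using (Fin)
open import Data.Fin.Properties using () renaming (_≟_ to _≟F_)
open import Data.Sum using (_⊎_; inj₁; inj₂)
open import Data.Product using (_×_; _,_; proj₁; proj₂; Σ; ∃; ∃-syntax)
open import Data.List using (List; []; _∷_; length; lookup; head; last)
open import Data.List.Membership.Propositional using (_∈_)
open import Data.List.Relation.Unary.Unique.Propositional using (Unique)
open import Data.Maybe using (Maybe; just)
open import Data.Unit using (⊤)
open import Data.Empty using (⊥)
open import Relation.Nullary using (¬_; yes; no)
open import Relation.Binary.PropositionalEquality using (_≡_; _≢_)

-- Vertex set A ∪ B of K_{A,B}, with A = Fin a, B = Fin b (disjoint by construction).
V : ℕ → ℕ → Set
V a b = Fin a ⊎ Fin b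

AdjK : {a b : ℕ} → V a b → V a b → Set
AdjK (inj₁ _) (inj₂ _) = ⊤
AdjK (inj₂ _) (inj₁ _) = ⊤
AdjK (inj₁ _) (inj₁ _) = ⊥
AdjK (inj₂ _) (inj₂ _) = ⊥

steps : {X : Set} → List X → List (X × X)
steps []           = []
steps (x ∷ [])     = []
steps (x ∷ y ∷ xs) = (x , y) ∷ steps (y ∷ xs)

AllAdj : {a b : ℕ} → List (V a b) → Set
AllAdj []           = ⊤
AllAdj (x ∷ [])     = ⊤
AllAdj (x ∷ y ∷ xs) = AdjK x y × AllAdj (y ∷ xs)

IsPathK : {a b : ℕ} → V a b → V a b → List (V a b) → Set
IsPathK u v P = (head P ≡ just u) × (last P ≡ just v) × AllAdj P × Unique P

ShareEdge : {X : Set} → List X → List X → Set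
ShareEdge {X} P Q = Σ X λ u → Σ X λ v →
  ((u , v) ∈ steps P) × (((u , v) ∈ steps Q) ⊎ ((v , u) ∈ steps Q))

-- A bipartite demand graph with color classes A, B: a finite multiset of edges
-- between A and B, represented as a list (multiplicity = number of occurrences).
Demand : ℕ → ℕ → Set
Demand a b = List (Fin a × Fin b)

degA : {a b : ℕ} → Demand a b → Fin a → ℕ
degA [] x = 0
degA ((x' , _) ∷ D) x with x' ≟F x
... | yes _ = suc (degA D x)
... | no  _ = degA D x

degB : {a b : ℕ} → Demand a b → Fin b → ℕ
degB [] y = 0
degB ((_ , y') ∷ D) y with y' ≟F y
... | yes _ = suc (degB D y)
... | no  _ = degB D y

Resolvable : {a b : ℕ} → Demand a b → Set
Resolvable {a} {b} D =
  Σ (Fin (length D) → List (V a b)) λ path →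
    (∀ i → IsPathK (inj₁ (proj₁ (lookup D i))) (inj₂ (proj₂ (lookup D i))) (path i))
    × (∀ i j → i ≢ j → ¬ ShareEdge (path i) (path j))

{-# OPTIONS --safe #-}
-- Take ε(m) = 9/m. Split B into two nearly equal halves and route a demand e = (x , y) along a path
-- x – f e – g e – y, where f e lies in the half not containing y.
--
-- Choice of f: the values f e are distinct at each x, and each is taken at most L ≈ a/4 times. This is a
-- proper edge colouring (Kőnig) of a bipartite graph between A and groups of demands.
--
-- Choice of g: the pairs {f e , y e} form a bipartite multigraph between the halves, of maximum degree at
-- most a/4 + L ≈ a/2. The paths are edge-disjoint as soon as g is a proper edge colouring of it that avoids,
-- on {u , v}, the x-ends of the demands with f-value u or v. These are at most 2L ≈ a/2 forbidden
-- colours, so the lists have size at least the maximum degree and Galvin's theorem applies.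
module Submission where

open import Defs
import Data.Nat as ℕ
open import Data.Nat using (ℕ; zero; suc; _+_; _∸_; _≤_; _<_; z≤n; s≤s; s≤s⁻¹; _<?_; _≤?_; NonZero) renaming (_≟_ to _≟ℕ_)
open import Data.Nat.Properties
open import Data.Nat.DivMod using (m≡m%n+[m/n]*n; m%n<n; m<n*o⇒m/o<n; m/n*n≤m; m*n/n≡m; /-monoˡ-≤)
open import Data.Nat.Tactic.RingSolver using (solve-∀)
open import Data.Fin using (Fin)
open import Data.Fin.Properties using () renaming (_≟_ to _≟F_)
open import Data.List using (List; []; _∷_; _++_; length; map; filter; upTo; lookup; allFin)
import Data.List.Extrema ≤-totalOrder as Extrema
open import Data.List.Properties
  using (length-++; length-map; length-upTo; length-tabulate; filter-accept; filter-reject; filter-notAll;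
         tabulate-lookup; map-tabulate)
open import Data.List.Membership.Propositional using (_∈_; _∉_; find; lose)
open import Data.List.Membership.Propositional.Properties
  using (∈-∃++; ∈-++⁺ˡ; ∈-++⁺ʳ; ∈-++⁻; ∈-filter⁺; ∈-filter⁻; ∈-map⁺; ∈-map⁻; ∈-upTo⁺; ∈-upTo⁻; ∈-allFin)
open import Data.List.Membership.DecPropositional using () renaming (_∈?_ to mem?)
open import Data.List.Relation.Binary.Subset.Propositional using (_⊆_)
open import Data.List.Relation.Unary.Any using (Any; here; there; any?)
open import Data.List.Relation.Unary.All as All using (All; []; _∷_)
open import Data.List.Relation.Unary.All.Properties using (¬Any⇒All¬; ++⁻ˡ)
open import Data.List.Relation.Unary.AllPairs using ([]; _∷_; tail)
open import Data.List.Relation.Unary.Unique.Propositional using (Unique)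
open import Data.List.Relation.Unary.Unique.Propositional.Properties using (filter⁺; Unique[x∷xs]⇒x∉xs; upTo⁺; allFin⁺)
open import Data.Product using (_×_; _,_; proj₁; proj₂; ∃-syntax; Σ)
open import Data.Sum using (_⊎_; inj₁; inj₂)
open import Data.Sum.Properties using (inj₁-injective; inj₂-injective)
open import Data.Unit using (tt)
open import Relation.Nullary using (¬_; Dec; yes; no; ¬?; contradiction)
open import Relation.Nullary.Decidable using (_×-dec_; _⊎-dec_; decidable-stable)
open import Relation.Unary using (Decidable)
open import Relation.Binary.Definitions using (DecidableEquality; tri<; tri≈; tri>)
open import Relation.Binary.PropositionalEquality
open import Function using (_∘_)

-- Counting in duplicate-free lists.

private variable
  X Y : Set

module _ {X : Set} {P : X → Set} (P? : Decidable P) where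
  count : List X → ℕ
  count xs = length (filter P? xs)

Unique-⊆⇒length≤ : {xs ys : List X} → Unique xs → xs ⊆ ys → length xs ≤ length ys
Unique-⊆⇒length≤ {xs = []} _ _ = z≤n
Unique-⊆⇒length≤ {xs = x ∷ xs} u@(_ ∷ uxs) xs⊆ys
  with as , bs , refl ← ∈-∃++ (xs⊆ys (here refl)) = begin
    suc (length xs)              ≤⟨ s≤s (Unique-⊆⇒length≤ uxs drop-x) ⟩
    suc (length (as ++ bs))      ≡⟨ cong suc (length-++ as) ⟩
    suc (length as + length bs)  ≡⟨ +-suc (length as) (length bs) ⟨
    length as + suc (length bs)  ≡⟨ length-++ as ⟨
    length (as ++ x ∷ bs)        ∎
  where
  open ≤-Reasoning
  drop-x : xs ⊆ as ++ bs
  drop-x {y} y∈xs with ∈-++⁻ as (xs⊆ys (there y∈xs))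
  ... | inj₁ y∈as         = ∈-++⁺ˡ y∈as
  ... | inj₂ (here refl)  = contradiction y∈xs (Unique[x∷xs]⇒x∉xs u)
  ... | inj₂ (there y∈bs) = ∈-++⁺ʳ as y∈bs

Unique-map : {xs : List X} (g : X → Y) → (∀ {x y} → x ∈ xs → y ∈ xs → g x ≡ g y → x ≡ y) →
             Unique xs → Unique (map g xs)
Unique-map {xs = []}     g inj _          = []
Unique-map {xs = x ∷ xs} g inj u@(_ ∷ uxs) =
  All.tabulate fresh ∷ Unique-map g (λ i j → inj (there i) (there j)) uxs
  where
  fresh : ∀ {z} → z ∈ map g xs → g x ≢ z
  fresh z∈ gx≡z with y , y∈xs , refl ← ∈-map⁻ g z∈ =
    Unique[x∷xs]⇒x∉xs u (subst (_∈ xs) (sym (inj (here refl) (there y∈xs) gx≡z)) y∈xs)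

injection⇒length≤ : {xs : List X} {ys : List Y} (g : X → Y) → Unique xs →
  (∀ {x y} → x ∈ xs → y ∈ xs → g x ≡ g y → x ≡ y) → (∀ {x} → x ∈ xs → g x ∈ ys) →
  length xs ≤ length ys
injection⇒length≤ {xs = xs} {ys} g u inj to =
  subst (_≤ length ys) (length-map g xs) (Unique-⊆⇒length≤ (Unique-map g inj u) image⊆)
  where
  image⊆ : map g xs ⊆ ys
  image⊆ z∈ with _ , x∈ , refl ← ∈-map⁻ g z∈ = to x∈

∃-∉ : DecidableEquality X → {xs ys : List X} → Unique xs → length ys < length xs →
      ∃[ x ] x ∈ xs × x ∉ ys
∃-∉ _≟_ {xs} {ys} u lt with any? (λ x → ¬? (mem? _≟_ x ys)) xs
... | yes some = find some
... | no none  = contradiction (Unique-⊆⇒length≤ u sub) (<⇒≱ lt)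
  where
  sub : xs ⊆ ys
  sub {x} x∈ with mem? _≟_ x ys
  ... | yes x∈ys = x∈ys
  ... | no  x∉ys = contradiction (lose x∈ x∉ys) none

module _ {P : X → Set} (P? : Decidable P) where
  count-accept : ∀ {x} {xs : List X} → P x → count P? (x ∷ xs) ≡ suc (count P? xs)
  count-accept px = cong length (filter-accept P? px)

  count-reject : ∀ {x} {xs : List X} → ¬ P x → count P? (x ∷ xs) ≡ count P? xs
  count-reject ¬px = cong length (filter-reject P? ¬px)

  count-∷ : ∀ x (xs : List X) → count P? xs ≤ count P? (x ∷ xs)
  count-∷ x xs with P? x
  ... | yes _ = n≤1+n _
  ... | no  _ = ≤-refl

  length≡count+count¬ : ∀ xs → length xs ≡ count P? xs + count (¬? ∘ P?) xs
  length≡count+count¬ []       = refl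
  length≡count+count¬ (x ∷ xs) with P? x
  ... | yes _ = cong suc (length≡count+count¬ xs)
  ... | no  _ = trans (cong suc (length≡count+count¬ xs)) (sym (+-suc (count P? xs) _))

  count-mono : {Q : X → Set} (Q? : Decidable Q) {xs ys : List X} → Unique xs →
    (∀ {x} → x ∈ xs → P x → x ∈ ys × Q x) → count P? xs ≤ count Q? ys
  count-mono Q? {xs} {ys} u imp = Unique-⊆⇒length≤ (filter⁺ P? u) sub
    where
    sub : filter P? xs ⊆ filter Q? ys
    sub x∈ with x∈xs , px ← ∈-filter⁻ P? {xs = xs} x∈ with x∈ys , qx ← imp x∈xs px = ∈-filter⁺ Q? x∈ys qx

count-∪ : {X : Set} {P Q S : X → Set} (P? : Decidable P) (Q? : Decidable Q) (S? : Decidable S) →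
  (∀ {x} → P x → Q x ⊎ S x) → ∀ {xs} → Unique xs → count P? xs ≤ count Q? xs + count S? xs
count-∪ P? Q? S? imp {xs} u = subst (count P? xs ≤_) (length-++ (filter Q? xs))
  (Unique-⊆⇒length≤ (filter⁺ P? u) sub)
  where
  sub : filter P? xs ⊆ filter Q? xs ++ filter S? xs
  sub x∈ with x∈xs , px ← ∈-filter⁻ P? {xs = xs} x∈ with imp px
  ... | inj₁ qx = ∈-++⁺ˡ (∈-filter⁺ Q? x∈xs qx)
  ... | inj₂ sx = ∈-++⁺ʳ (filter Q? xs) (∈-filter⁺ S? x∈xs sx)

module _ {X : Set} (_≟_ : DecidableEquality X) where
  -- Numbers the edges of a list so that they can be cut into consecutive blocks. An absent element
  -- gets the length of the list, which is no true position.
  position : List X → X → ℕ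
  position []       y = 0
  position (x ∷ xs) y with x ≟ y
  ... | yes _ = 0
  ... | no  _ = suc (position xs y)

  position< : ∀ {xs x} → x ∈ xs → position xs x < length xs
  position< {x ∷ xs} {y} y∈ with x ≟ y | y∈
  ... | yes _ | _         = s≤s z≤n
  ... | no ne | here eq   = contradiction (sym eq) ne
  ... | no _  | there y∈′ = s≤s (position< y∈′)

  position-injective : ∀ {xs x y} → x ∈ xs → y ∈ xs → position xs x ≡ position xs y → x ≡ y
  position-injective {z ∷ zs} {x} {y} x∈ y∈ eq with z ≟ x | z ≟ y | x∈ | y∈
  ... | yes refl | yes refl | _         | _         = refl
  ... | no ne    | no _     | here eq′  | _         = contradiction (sym eq′) ne
  ... | no _     | no ne    | there _   | here eq′  = contradiction (sym eq′) ne
  ... | no _     | no _     | there x∈′ | there y∈′ = position-injective x∈′ y∈′ (suc-injective eq)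

split-at : {X : Set} (k : ℕ) (xs : List X) → k < length xs →
  ∃[ ys ] ∃[ z ] ∃[ zs ] xs ≡ ys ++ z ∷ zs × length ys ≡ k
split-at zero    (x ∷ xs) _        = [] , x , xs , refl , refl
split-at (suc k) (x ∷ xs) (s≤s lt) with ys , z , zs , refl , len ← split-at k xs lt =
  x ∷ ys , z , zs , refl , cong suc len

Unique-++⁻ : {X : Set} (xs : List X) {ys : List X} → Unique (xs ++ ys) →
  Unique xs × Unique ys × (∀ {x} → x ∈ xs → x ∉ ys)
Unique-++⁻ []       u            = [] , u , λ ()
Unique-++⁻ (x ∷ xs) {ys} u@(px ∷ u′) with uxs , uys , disjoint ← Unique-++⁻ xs u′ =
  ++⁻ˡ xs px ∷ uxs , uys , disjoint′
  where
  disjoint′ : ∀ {v} → v ∈ x ∷ xs → v ∉ ys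
  disjoint′ (here refl) j = Unique[x∷xs]⇒x∉xs u (∈-++⁺ʳ xs j)
  disjoint′ (there i)   j = disjoint i j

-- Closure of a monotone rule on a finite list.

module LeastFixedPoint {E : Set} (_≟_ : DecidableEquality E) (R : List E)
  (Step : List E → E → Set) (step? : ∀ Z e → Dec (Step Z e))
  (weaken : ∀ {Z e} z → Step Z e → Step (z ∷ Z) e) where

  record FixedPoint : Set where
    field
      carrier  : List E
      sound    : ∀ {e} → e ∈ carrier → Step carrier e
      complete : ∀ {e} → e ∈ R → Step carrier e → e ∈ carrier

  -- Each round adds a new element of `R`, so `fuel + length Z` keeps its value, and running out of
  -- fuel would make `Z` longer than `R`. Monotonicity of `Step` keeps the earlier elements
  -- justified.
  grow : ∀ fuel Z → Unique Z → Z ⊆ R → (∀ {e} → e ∈ Z → Step Z e) →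
         length R < fuel + length Z → FixedPoint
  grow zero       Z u Z⊆R sound lt = contradiction (Unique-⊆⇒length≤ u Z⊆R) (<⇒≱ lt)
  grow (suc fuel) Z u Z⊆R sound lt
    with any? (λ e → step? Z e ×-dec ¬? (mem? _≟_ e Z)) R
  ... | no none = record { carrier = Z ; sound = sound ; complete = complete }
    where
    complete : ∀ {e} → e ∈ R → Step Z e → e ∈ Z
    complete {e} e∈R s with mem? _≟_ e Z
    ... | yes e∈Z = e∈Z
    ... | no  e∉Z = contradiction (lose e∈R (s , e∉Z)) none
  ... | yes some with e , e∈R , s , e∉Z ← find some =
    grow fuel (e ∷ Z) (¬Any⇒All¬ Z e∉Z ∷ u) sub sound′
      (subst (length R <_) (sym (+-suc fuel (length Z))) lt)
    where
    sub : e ∷ Z ⊆ R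
    sub (here refl) = e∈R
    sub (there z∈)  = Z⊆R z∈
    sound′ : ∀ {f} → f ∈ e ∷ Z → Step (e ∷ Z) f
    sound′ (here refl) = weaken e s
    sound′ (there z∈)  = weaken e (sound z∈)

  fixedPoint : FixedPoint
  fixedPoint = grow (suc (length R)) [] [] (λ ()) (λ ()) (s≤s (m≤m+n (length R) 0))

-- Kőnig's edge colouring theorem by Kempe chains.

module BipartiteMultigraph {E VP VQ : Set} (_≟E_ : DecidableEquality E)
  (_≟P_ : DecidableEquality VP) (_≟Q_ : DecidableEquality VQ) (p : E → VP) (q : E → VQ) where

  Adjacent : E → E → Set
  Adjacent e f = p e ≡ p f ⊎ q e ≡ q f

  degP : List E → VP → ℕ
  degP R u = count (λ e → p e ≟P u) R

  degQ : List E → VQ → ℕ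
  degQ R v = count (λ e → q e ≟Q v) R

  Proper : {C : Set} → List E → (E → C) → Set
  Proper R c = ∀ {e f} → e ∈ R → f ∈ R → Adjacent e f → c e ≡ c f → e ≡ f

  module _ {C : Set} (_≟C_ : DecidableEquality C) where

    missing : (cs : List C) → Unique cs → {I : E → Set} (I? : Decidable I) (R : List E) (c : E → C) →
      count I? R < length cs → ∃[ γ ] γ ∈ cs × (∀ {f} → f ∈ R → I f → c f ≢ γ)
    missing cs ucs I? R c lt
      with γ , γ∈ , γ∉ ← ∃-∉ _≟C_ ucs (subst (_< length cs) (sym (length-map c (filter I? R))) lt) =
      γ , γ∈ , λ f∈ If eq → γ∉ (subst (_∈ map c (filter I? R)) eq (∈-map⁺ c (∈-filter⁺ I? f∈ If)))

    -- The new edge e₀ gets the colour α missing at its P-end; the colours α, β are exchanged on the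
    -- Kempe chain starting with the α-edge at the Q-end, where β is missing.
    module KempeChain (e₀ : E) (R : List E) (c : E → C) (proper : Proper R c) (α β : C)
      (α-missing : ∀ {f} → f ∈ R → p f ≡ p e₀ → c f ≢ α)
      (β-missing : ∀ {f} → f ∈ R → q f ≡ q e₀ → c f ≢ β) where

      -- The chain is given by reachability instead of as a walk. An `α`-edge is entered at its
      -- Q-end and a `β`-edge at its P-end, so every P-vertex of the chain carries a chain edge of
      -- colour `α`. Hence the chain avoids `p e₀`, where `α` is missing.
      Step : List E → E → Set
      Step Z e = e ∈ R ×
        ((c e ≡ α × (q e ≡ q e₀ ⊎ Any (λ z → c z ≡ β × q e ≡ q z) Z))
        ⊎ (c e ≡ β × Any (λ z → c z ≡ α × p e ≡ p z) Z))

      step? : ∀ Z e → Dec (Step Z e)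
      step? Z e = mem? _≟E_ e R ×-dec
        (((c e ≟C α) ×-dec ((q e ≟Q q e₀) ⊎-dec any? (λ z → (c z ≟C β) ×-dec (q e ≟Q q z)) Z))
        ⊎-dec ((c e ≟C β) ×-dec any? (λ z → (c z ≟C α) ×-dec (p e ≟P p z)) Z))

      weaken : ∀ {Z e} z → Step Z e → Step (z ∷ Z) e
      weaken z (e∈ , inj₁ (eq , inj₁ at)) = e∈ , inj₁ (eq , inj₁ at)
      weaken z (e∈ , inj₁ (eq , inj₂ a))  = e∈ , inj₁ (eq , inj₂ (there a))
      weaken z (e∈ , inj₂ (eq , a))       = e∈ , inj₂ (eq , there a)

      open LeastFixedPoint _≟E_ R Step step? weaken
      open FixedPoint fixedPoint renaming (carrier to Z)

      swap : C → C
      swap γ with γ ≟C α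
      ... | yes _ = β
      ... | no  _ = α

      swap-α : ∀ {γ} → γ ≡ α → swap γ ≡ β
      swap-α {γ} eq with γ ≟C α
      ... | yes _ = refl
      ... | no ne = contradiction eq ne

      swap-β : ∀ {γ} → γ ≡ β → swap γ ≡ α
      swap-β {γ} eq with γ ≟C α
      -- `α` and `β` may be the same colour; the exchange is then trivial.
      ... | yes eq′ = trans (sym eq) eq′
      ... | no  _   = refl

      inserted : E → C
      inserted e with e ≟E e₀
      ... | yes _ = α
      ... | no  _ with mem? _≟E_ e Z
      ...   | yes _ = swap (c e)
      ...   | no  _ = c e

      swapped-injective : ∀ {e f} → e ∈ Z → f ∈ Z → swap (c e) ≡ swap (c f) → c e ≡ c f
      swapped-injective e∈ f∈ eq with sound e∈ | sound f∈
      ... | _ , inj₁ (ce , _) | _ , inj₁ (cf , _) = trans ce (sym cf)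
      ... | _ , inj₂ (ce , _) | _ , inj₂ (cf , _) = trans ce (sym cf)
      ... | _ , inj₁ (ce , _) | _ , inj₂ (cf , _) =
        trans ce (trans (sym (swap-β cf)) (trans (sym eq) (trans (swap-α ce) (sym cf))))
      ... | _ , inj₂ (ce , _) | _ , inj₁ (cf , _) =
        trans ce (trans (sym (swap-α cf)) (trans (sym eq) (trans (swap-β ce) (sym cf))))

      -- The danger is a chain edge turning from `β` to `α` next to `e₀`. At `q e₀` no edge has
      -- colour `β`; at `p e₀` such an edge would have been reached through an `α`-edge at the same
      -- vertex, and there is none.
      new-vs-swapped : ∀ {f} → f ∈ Z → Adjacent e₀ f → swap (c f) ≢ α
      new-vs-swapped f∈ adj eq with sound f∈ | adj
      ... | f∈R , inj₁ (cf , _) | inj₁ pe = α-missing f∈R (sym pe) cf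
      ... | f∈R , inj₁ (cf , _) | inj₂ qe =
        β-missing f∈R (sym qe) (trans cf (trans (sym eq) (swap-α cf)))
      ... | f∈R , inj₂ (cf , a) | inj₁ pe with z , z∈ , cz , pz ← find a =
        α-missing (proj₁ (sound z∈)) (trans (sym pz) (sym pe)) cz
      ... | f∈R , inj₂ (cf , a) | inj₂ qe = β-missing f∈R (sym qe) cf

      new-vs-kept : ∀ {f} → f ∈ R → f ∉ Z → Adjacent e₀ f → c f ≢ α
      new-vs-kept f∈R f∉Z (inj₁ pe) cf = α-missing f∈R (sym pe) cf
      new-vs-kept f∈R f∉Z (inj₂ qe) cf = f∉Z (complete f∈R (f∈R , inj₁ (cf , inj₁ (sym qe))))

      -- An edge `f` that meets `e` and has the other colour belongs to the chain itself: either
      -- closure adds it, or properness identifies it with the edge through which `e` was reached.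
      -- At the start of the chain, `q e₀` has no `β`-edge at all.
      swapped-vs-kept : ∀ {e f} → e ∈ Z → f ∈ R → f ∉ Z → Adjacent e f → swap (c e) ≢ c f
      swapped-vs-kept e∈ f∈R f∉Z adj eq with sound e∈ | adj
      ... | e∈R , inj₁ (ce , _) | inj₁ pe =
        f∉Z (complete f∈R (f∈R , inj₂ (trans (sym eq) (swap-α ce) , lose e∈ (ce , sym pe))))
      ... | e∈R , inj₁ (ce , inj₁ qe₀) | inj₂ qe =
        β-missing f∈R (trans (sym qe) qe₀) (trans (sym eq) (swap-α ce))
      ... | e∈R , inj₁ (ce , inj₂ a) | inj₂ qe with z , z∈ , cz , qz ← find a =
        f∉Z (subst (_∈ Z) (proper (proj₁ (sound z∈)) f∈R (inj₂ (trans (sym qz) qe))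
          (trans cz (trans (sym (swap-α ce)) eq))) z∈)
      ... | e∈R , inj₂ (ce , a) | inj₁ pe with z , z∈ , cz , pz ← find a =
        f∉Z (subst (_∈ Z) (proper (proj₁ (sound z∈)) f∈R (inj₁ (trans (sym pz) pe))
          (trans cz (trans (sym (swap-β ce)) eq))) z∈)
      ... | e∈R , inj₂ (ce , _) | inj₂ qe =
        f∉Z (complete f∈R (f∈R , inj₁ (trans (sym eq) (swap-β ce) , inj₂ (lose e∈ (ce , sym qe)))))

      Adjacent-sym : ∀ {e f} → Adjacent e f → Adjacent f e
      Adjacent-sym (inj₁ eq) = inj₁ (sym eq)
      Adjacent-sym (inj₂ eq) = inj₂ (sym eq)

      tail-member : ∀ {e} → e ∈ e₀ ∷ R → e ≢ e₀ → e ∈ R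
      tail-member (here eq)  ne = contradiction eq ne
      tail-member (there e∈) _  = e∈

      inserted-proper : Proper (e₀ ∷ R) inserted
      inserted-proper {e} {f} e∈ f∈ adj eq with e ≟E e₀ | f ≟E e₀
      ... | yes refl | yes refl = refl
      ... | yes refl | no f≢ with mem? _≟E_ f Z
      ...   | yes f∈Z = contradiction (sym eq) (new-vs-swapped f∈Z adj)
      ...   | no  f∉Z = contradiction (sym eq) (new-vs-kept (tail-member f∈ f≢) f∉Z adj)
      inserted-proper {e} {f} e∈ f∈ adj eq | no e≢ | yes refl with mem? _≟E_ e Z
      ...   | yes e∈Z = contradiction eq (new-vs-swapped e∈Z (Adjacent-sym adj))
      ...   | no  e∉Z = contradiction eq (new-vs-kept (tail-member e∈ e≢) e∉Z (Adjacent-sym adj))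
      inserted-proper {e} {f} e∈ f∈ adj eq | no e≢ | no f≢ with mem? _≟E_ e Z | mem? _≟E_ f Z
      ... | yes e∈Z | yes f∈Z = proper (tail-member e∈ e≢) (tail-member f∈ f≢) adj (swapped-injective e∈Z f∈Z eq)
      ... | yes e∈Z | no  f∉Z = contradiction eq (swapped-vs-kept e∈Z (tail-member f∈ f≢) f∉Z adj)
      ... | no  e∉Z | yes f∈Z = contradiction (sym eq) (swapped-vs-kept f∈Z (tail-member e∈ e≢) e∉Z (Adjacent-sym adj))
      ... | no  _   | no  _   = proper (tail-member e∈ e≢) (tail-member f∈ f≢) adj eq

      inserted-∈ : ∀ {cs} → α ∈ cs → β ∈ cs → (∀ {e} → e ∈ R → c e ∈ cs) → ∀ {e} → e ∈ e₀ ∷ R → inserted e ∈ cs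
      inserted-∈ α∈ β∈ c∈ {e} e∈ with e ≟E e₀
      ... | yes _ = α∈
      ... | no e≢ with mem? _≟E_ e Z
      ...   | no  _ = c∈ (tail-member e∈ e≢)
      ...   | yes _ with c e ≟C α
      ...     | yes _ = β∈
      ...     | no  _ = α∈

    -- Edges are inserted one at a time. The degree bounds count the new edge too, so the edges
    -- already coloured leave a colour free at each of its ends. `c₀` serves as the colouring of the
    -- empty list, as `C` might have no elements.
    könig : (cs : List C) → Unique cs → (R : List E) →
      (∀ u → degP R u ≤ length cs) → (∀ v → degQ R v ≤ length cs) →
      (E → C) →
      ∃[ c ] Proper {C} R c × (∀ {e} → e ∈ R → c e ∈ cs)
    könig cs ucs []       dP dQ c₀ = c₀ , (λ ()) , λ ()
    könig cs ucs (e₀ ∷ R) dP dQ c₀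
      with c , proper , c∈ ← könig cs ucs R (λ u → ≤-trans (count-∷ (λ e → p e ≟P u) e₀ R) (dP u))
                                            (λ v → ≤-trans (count-∷ (λ e → q e ≟Q v) e₀ R) (dQ v)) c₀
      with α , α∈ , α-missing ← missing cs ucs (λ e → p e ≟P p e₀) R c
             (subst (_≤ length cs) (count-accept (λ e → p e ≟P p e₀) refl) (dP (p e₀)))
      with β , β∈ , β-missing ← missing cs ucs (λ e → q e ≟Q q e₀) R c
             (subst (_≤ length cs) (count-accept (λ e → q e ≟Q q e₀) refl) (dQ (q e₀))) =
      inserted , inserted-proper , inserted-∈ α∈ β∈ c∈
      where open KempeChain e₀ R c proper α β α-missing β-missing

-- Galvin's list edge colouring theorem.

module Galvin {E VP VQ : Set} (_≟E_ : DecidableEquality E)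
  (_≟P_ : DecidableEquality VP) (_≟Q_ : DecidableEquality VQ) (p : E → VP) (q : E → VQ)
  (c : E → ℕ) where

  open BipartiteMultigraph _≟E_ _≟P_ _≟Q_ p q

  -- Galvin's orientation of the line graph: P-vertices prefer larger colours and Q-vertices smaller
  -- ones. Under these opposite preferences the dominators of `e` at its P-end have colours above
  -- `c e`, those at its Q-end colours below.
  Dominates : E → E → Set
  Dominates e f = (p f ≡ p e × c e < c f) ⊎ (q f ≡ q e × c f < c e)

  dominates? : ∀ e → Decidable (Dominates e)
  dominates? e f = ((p f ≟P p e) ×-dec (c e <? c f)) ⊎-dec ((q f ≟Q q e) ×-dec (c f <? c e))

  record Kernel (S : List E) : Set where
    field
      carrier     : List E
      carrier⊆    : carrier ⊆ S
      independent : ∀ {e f} → e ∈ carrier → f ∈ carrier → Adjacent e f → e ≡ f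
      absorbing   : ∀ {e} → e ∈ S → e ∈ carrier ⊎ Any (Dominates e) carrier

  Top : List E → E → Set
  Top S e = ¬ Any (λ g → p g ≡ p e × c e < c g) S

  top? : ∀ S → Decidable (Top S)
  top? S e = ¬? (any? (λ g → (p g ≟P p e) ×-dec (c e <? c g)) S)

  ∃-top : ∀ {S e} → e ∈ S → ∃[ g ] g ∈ S × Top S g × p g ≡ p e × c e ≤ c g
  ∃-top {S} {e} e∈ = g , proj₁ g-in , top , proj₂ g-in , Extrema.f[⊥]≤f[argmax] {f = c} e at-e
    where
    at-e : List E
    at-e = filter (λ g → p g ≟P p e) S
    g : E
    g = Extrema.argmax c e at-e
    g-in : g ∈ S × p g ≡ p e
    g-in = Extrema.argmax-all c {P = λ g → g ∈ S × p g ≡ p e} (e∈ , refl)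
             (All.tabulate (∈-filter⁻ (λ g → p g ≟P p e) {xs = S}))
    top : Top S g
    top above with h , h∈ , ph , c< ← find above =
      <⇒≱ c< (All.lookup (Extrema.f[xs]≤f[argmax] {f = c} e at-e)
                (∈-filter⁺ (λ g → p g ≟P p e) h∈ (trans ph (proj₂ g-in))))

  -- Gale–Shapley: an edge beaten at its Q-end by the favourite of some P-vertex is dominated by every
  -- kernel of the remaining edges, so it may be discarded.
  kernel : ∀ n S → Proper S c → length S ≤ n → Kernel S
  kernel n S proper len
    with any? (λ e′ → any? (λ e → top? S e ×-dec ((q e ≟Q q e′) ×-dec (c e <? c e′))) S) S
  -- The favourites of the P-vertices now form a kernel: of two favourites at one Q-vertex one would
  -- beat the other, and every other edge is dominated by the favourite at its own P-end.
  kernel n S proper len | no none = record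
    { carrier = tops ; carrier⊆ = proj₁ ∘ member ; independent = independent ; absorbing = absorbing }
    where
    tops : List E
    tops = filter (top? S) S
    member : ∀ {e} → e ∈ tops → e ∈ S × Top S e
    member = ∈-filter⁻ (top? S) {xs = S}
    independent : ∀ {e f} → e ∈ tops → f ∈ tops → Adjacent e f → e ≡ f
    independent {e} {f} e∈ f∈ adj with e∈S , te ← member e∈ | f∈S , tf ← member f∈ with <-cmp (c e) (c f) | adj
    ... | tri≈ _ eq _ | _       = proper e∈S f∈S adj eq
    ... | tri< lt _ _ | inj₁ pe = contradiction (lose f∈S (sym pe , lt)) te
    ... | tri> _ _ gt | inj₁ pe = contradiction (lose e∈S (pe , gt)) tf
    ... | tri< lt _ _ | inj₂ qe = contradiction (lose f∈S (lose e∈S (te , qe , lt))) none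
    ... | tri> _ _ gt | inj₂ qe = contradiction (lose e∈S (lose f∈S (tf , sym qe , gt))) none
    absorbing : ∀ {e} → e ∈ S → e ∈ tops ⊎ Any (Dominates e) tops
    absorbing {e} e∈ with g , g∈ , tg , pg , c≤ ← ∃-top e∈ with m≤n⇒m<n∨m≡n c≤
    ... | inj₁ c< = inj₂ (lose (∈-filter⁺ (top? S) g∈ tg) (inj₁ (pg , c<)))
    ... | inj₂ eq = inj₁ (subst (_∈ tops) (sym (proper e∈ g∈ (inj₁ (sym pg)) eq)) (∈-filter⁺ (top? S) g∈ tg))
  kernel zero [] proper len | yes ()
  kernel (suc n) S proper len | yes some
    with e′ , e′∈ , some′ ← find some with e , e∈ , te , qe , c< ← find some′ = record
      { carrier = carrier ; carrier⊆ = proj₁ ∘ member ∘ carrier⊆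
      ; independent = independent ; absorbing = absorbing′ }
    where
    rest : List E
    rest = filter (λ g → ¬? (g ≟E e′)) S
    member : ∀ {g} → g ∈ rest → g ∈ S × g ≢ e′
    member = ∈-filter⁻ (λ g → ¬? (g ≟E e′)) {xs = S}
    shorter : length rest ≤ n
    shorter = s≤s⁻¹ (≤-trans (filter-notAll (λ g → ¬? (g ≟E e′)) S (lose e′∈ (λ ne → ne refl))) len)
    open Kernel (kernel n rest (λ i j → proper (proj₁ (member i)) (proj₁ (member j))) shorter)
    e≢e′ : e ≢ e′
    e≢e′ refl = <-irrefl refl c<
    absorbing′ : ∀ {g} → g ∈ S → g ∈ carrier ⊎ Any (Dominates g) carrier
    absorbing′ {g} g∈ with g ≟E e′
    ... | no ne = absorbing (∈-filter⁺ (λ g → ¬? (g ≟E e′)) g∈ ne)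
    -- The rival `e` of the discarded `e′` is in the kernel or dominated by a kernel edge. Being a
    -- favourite, `e` can only be dominated at its Q-end, and that domination passes on to `e′`.
    ... | yes refl with absorbing (∈-filter⁺ (λ g → ¬? (g ≟E e′)) e∈ e≢e′)
    ...   | inj₁ e∈M = inj₂ (lose e∈M (inj₂ (qe , c<)))
    ...   | inj₂ dom with h , h∈ , d ← find dom with d
    ...     | inj₁ (ph , ch) = contradiction (lose (proj₁ (member (carrier⊆ h∈))) (ph , ch)) te
    ...     | inj₂ (qh , ch) = inj₂ (lose h∈ (inj₂ (trans qh qe , <-trans ch c<)))

  module _ {A : Set} (Allowed : E → A → Set) (allowed? : ∀ e → Decidable (Allowed e)) where

    -- The kernel argument of Bondy, Boppana and Siegel, by induction on the palette: a kernel of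
    -- the edges allowing `α` takes the colour `α`. An edge left over either did not allow `α`, or
    -- loses `α` together with a dominator in the kernel, so its list stays longer than the number
    -- of its dominators. `φ₀` answers for the exhausted palette, where `dom<` forces `R` to be
    -- empty.
    listColouring : (as : List A) → Unique as → (R : List E) → Unique R → Proper R c →
      (∀ {e} → e ∈ R → count (dominates? e) R < count (allowed? e) as) →
      (E → A) →
      ∃[ φ ] Proper {A} R φ × (∀ {e} → e ∈ R → φ e ∈ as × Allowed e (φ e))
    listColouring []       uas R uR proper dom< φ₀ =
      φ₀ , (λ e∈ _ _ _ → contradiction (dom< e∈) λ ()) , λ e∈ → contradiction (dom< e∈) λ ()
    listColouring (α ∷ as) uas@(_ ∷ uas′) R uR proper dom< φ₀ = φ , φ-proper , φ-allowed
      where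
      α? : Decidable (λ e → Allowed e α)
      α? e = allowed? e α
      S : List E
      S = filter α? R
      S-member : ∀ {e} → e ∈ S → e ∈ R × Allowed e α
      S-member = ∈-filter⁻ α? {xs = R}
      open Kernel (kernel (length S) S (λ i j → proper (proj₁ (S-member i)) (proj₁ (S-member j))) ≤-refl)
        renaming (carrier to M)
      outside? : Decidable (λ e → e ∉ M)
      outside? e = ¬? (mem? _≟E_ e M)
      R′ : List E
      R′ = filter outside? R
      R′-member : ∀ {e} → e ∈ R′ → e ∈ R × e ∉ M
      R′-member = ∈-filter⁻ outside? {xs = R}

      dom<′ : ∀ {e} → e ∈ R′ → count (dominates? e) R′ < count (allowed? e) as
      dom<′ {e} e∈ with e∈R , e∉M ← R′-member e∈ with α? e
      ... | no not-allowed = subst (count (dominates? e) R′ <_) (count-reject (allowed? e) not-allowed)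
          (≤-<-trans (count-mono (dominates? e) (dominates? e) (filter⁺ outside? uR) λ f∈ d → proj₁ (R′-member f∈) , d)
                     (dom< e∈R))
      ... | yes ok with absorbing (∈-filter⁺ α? e∈R ok)
      ...   | inj₁ e∈M = contradiction e∈M e∉M
      ...   | inj₂ dom with m , m∈M , d ← find dom =
        s≤s⁻¹ (subst (suc (count (dominates? e) R′) <_) (count-accept (allowed? e) ok)
                 (≤-<-trans loses-one (dom< e∈R)))
        where
        loses-one : suc (count (dominates? e) R′) ≤ count (dominates? e) R
        loses-one = Unique-⊆⇒length≤ {xs = m ∷ filter (dominates? e) R′}
          (¬Any⇒All¬ _ (λ m∈ → proj₂ (R′-member (proj₁ (∈-filter⁻ (dominates? e) {xs = R′} m∈))) m∈M)
            ∷ filter⁺ (dominates? e) (filter⁺ outside? uR))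
          sub
          where
          sub : m ∷ filter (dominates? e) R′ ⊆ filter (dominates? e) R
          sub (here refl) = ∈-filter⁺ (dominates? e) (proj₁ (S-member (carrier⊆ m∈M))) d
          sub (there f∈) with f∈R′ , df ← ∈-filter⁻ (dominates? e) {xs = R′} f∈ =
            ∈-filter⁺ (dominates? e) (proj₁ (R′-member f∈R′)) df

      recursive : ∃[ φ′ ] Proper {A} R′ φ′ × (∀ {e} → e ∈ R′ → φ′ e ∈ as × Allowed e (φ′ e))
      recursive = listColouring as uas′ R′ (filter⁺ outside? uR)
        (λ i j → proper (proj₁ (R′-member i)) (proj₁ (R′-member j))) dom<′ φ₀

      φ′ : E → A
      φ′ = proj₁ recursive

      φ : E → A
      φ e with mem? _≟E_ e M
      ... | yes _ = α
      ... | no  _ = φ′ e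

      α∉as : α ∉ as
      α∉as = Unique[x∷xs]⇒x∉xs uas

      φ′-∈ : ∀ {e} → e ∈ R → e ∉ M → φ′ e ∈ as × Allowed e (φ′ e)
      φ′-∈ e∈ e∉ = proj₂ (proj₂ recursive) (∈-filter⁺ outside? e∈ e∉)

      φ-proper : Proper R φ
      φ-proper {e} {f} e∈ f∈ adj eq with mem? _≟E_ e M | mem? _≟E_ f M
      ... | yes e∈M | yes f∈M = independent e∈M f∈M adj
      ... | yes _   | no f∉M  = contradiction (subst (_∈ as) (sym eq) (proj₁ (φ′-∈ f∈ f∉M))) α∉as
      ... | no e∉M  | yes _   = contradiction (subst (_∈ as) eq (proj₁ (φ′-∈ e∈ e∉M))) α∉as
      ... | no e∉M  | no f∉M  = proj₁ (proj₂ recursive) (∈-filter⁺ outside? e∈ e∉M) (∈-filter⁺ outside? f∈ f∉M) adj eq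

      φ-allowed : ∀ {e} → e ∈ R → φ e ∈ α ∷ as × Allowed e (φ e)
      φ-allowed {e} e∈ with mem? _≟E_ e M
      ... | yes e∈M = here refl , proj₂ (S-member (carrier⊆ e∈M))
      ... | no e∉M with i , ok ← φ′-∈ e∈ e∉M = there i , ok

  -- The edge `e` and its dominators have distinct colours below `Δ`: dominators at the same end
  -- differ by properness, and `c e` separates those at the P-end from those at the Q-end.
  dominators< : ∀ {Δ} R → Unique R → Proper R c → (∀ {e} → e ∈ R → c e < Δ) →
    ∀ {e} → e ∈ R → count (dominates? e) R < Δ
  dominators< {Δ} R uR proper c<Δ {e} e∈ =
    subst (suc (count (dominates? e) R) ≤_) (length-upTo Δ)
      (injection⇒length≤ {xs = e ∷ filter (dominates? e) R} c
        (¬Any⇒All¬ _ (λ e∈′ → irreflexive (proj₂ (member e∈′))) ∷ filter⁺ (dominates? e) uR) inj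
        λ f∈ → ∈-upTo⁺ (c<Δ (in-R f∈)))
    where
    member : ∀ {f} → f ∈ filter (dominates? e) R → f ∈ R × Dominates e f
    member = ∈-filter⁻ (dominates? e) {xs = R}
    in-R : ∀ {f} → f ∈ e ∷ filter (dominates? e) R → f ∈ R
    in-R (here refl) = e∈
    in-R (there f∈)  = proj₁ (member f∈)
    c≢ : ∀ {f} → Dominates e f → c f ≢ c e
    c≢ (inj₁ (_ , lt)) eq = <-irrefl (sym eq) lt
    c≢ (inj₂ (_ , lt)) eq = <-irrefl eq lt
    irreflexive : ¬ Dominates e e
    irreflexive d = c≢ d refl
    inj : ∀ {f g} → f ∈ e ∷ filter (dominates? e) R → g ∈ e ∷ filter (dominates? e) R → c f ≡ c g → f ≡ g
    inj (here refl) (here refl) eq = refl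
    inj (here refl) (there g∈)  eq = contradiction (sym eq) (c≢ (proj₂ (member g∈)))
    inj (there f∈)  (here refl) eq = contradiction eq (c≢ (proj₂ (member f∈)))
    inj (there f∈)  (there g∈)  eq with f∈R , df ← member f∈ | g∈R , dg ← member g∈ with df | dg
    ... | inj₁ (pf , _)  | inj₁ (pg , _)  = proper f∈R g∈R (inj₁ (trans pf (sym pg))) eq
    ... | inj₂ (qf , _)  | inj₂ (qg , _)  = proper f∈R g∈R (inj₂ (trans qf (sym qg))) eq
    ... | inj₁ (_ , lt)  | inj₂ (_ , lt′) = contradiction (<-trans lt (subst (_< c e) (sym eq) lt′)) (<-irrefl refl)
    ... | inj₂ (_ , lt)  | inj₁ (_ , lt′) = contradiction (<-trans lt′ (subst (_< c e) eq lt)) (<-irrefl refl)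

module _ {E VP VQ A : Set} (_≟E_ : DecidableEquality E)
  (_≟P_ : DecidableEquality VP) (_≟Q_ : DecidableEquality VQ) (p : E → VP) (q : E → VQ)
  (Allowed : E → A → Set) (allowed? : ∀ e → Decidable (Allowed e)) where

  open BipartiteMultigraph _≟E_ _≟P_ _≟Q_ p q

  -- A Kőnig colouring with `Δ` colours fixes the orientation; each edge then has fewer than `Δ`
  -- dominators, hence fewer than its list has colours.
  galvin : ∀ Δ (as : List A) → Unique as → (R : List E) → Unique R →
    (∀ u → degP R u ≤ Δ) → (∀ v → degQ R v ≤ Δ) →
    (∀ {e} → e ∈ R → Δ ≤ count (allowed? e) as) →
    (E → A) →
    ∃[ φ ] Proper {A} R φ × (∀ {e} → e ∈ R → φ e ∈ as × Allowed e (φ e))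
  galvin Δ as uas R uR dP dQ lists φ₀
    with c , proper , c∈ ← könig _≟ℕ_ (upTo Δ) (upTo⁺ Δ) R
           (λ u → subst (degP R u ≤_) (sym (length-upTo Δ)) (dP u))
           (λ v → subst (degQ R v ≤_) (sym (length-upTo Δ)) (dQ v)) (λ _ → 0) =
    listColouring Allowed allowed? as uas R uR proper
      (λ e∈ → <-≤-trans (dominators< R uR proper (λ f∈ → ∈-upTo⁻ (c∈ f∈)) e∈) (lists e∈)) φ₀
    where open Galvin _≟E_ _≟P_ _≟Q_ p q c

-- Degrees of demand graphs as counts over indices.

count-map : {X Y : Set} {P : Y → Set} (P? : Decidable P) (g : X → Y) (xs : List X) →
  count (P? ∘ g) xs ≡ count P? (map g xs)
count-map P? g []       = refl
count-map P? g (x ∷ xs) with P? (g x)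
... | yes _ = cong suc (count-map P? g xs)
... | no  _ = count-map P? g xs

-- Parallel demands are equal as pairs, so the edges to be routed are the indices into `D`. This
-- carries degrees over from the list to its indices.
count-lookup : {Y : Set} {P : Y → Set} (P? : Decidable P) (ys : List Y) →
  count (P? ∘ lookup ys) (allFin (length ys)) ≡ count P? ys
count-lookup P? ys = trans (count-map P? (lookup ys) (allFin (length ys)))
  (cong (count P?) (trans (map-tabulate (λ i → i) (lookup ys)) (tabulate-lookup ys)))

count≡degA : ∀ {a b} (D : Demand a b) u → count (λ e → proj₁ e ≟F u) D ≡ degA D u
count≡degA []            u = refl
count≡degA ((x , _) ∷ D) u with x ≟F u
... | yes _ = cong suc (count≡degA D u)
... | no  _ = count≡degA D u

count≡degB : ∀ {a b} (D : Demand a b) v → count (λ e → proj₂ e ≟F v) D ≡ degB D v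
count≡degB []            v = refl
count≡degB ((_ , y) ∷ D) v with y ≟F v
... | yes _ = cong suc (count≡degB D v)
... | no  _ = count≡degB D v

-- Spreading edges evenly over a palette.

module _ where
  open import Data.Nat using (_*_; _/_; _%_)

  length≤fibres : {K : Set} (_≟_ : DecidableEquality K) (key : X → K) (d : ℕ) (ks : List K) {xs : List X} →
    Unique xs → (∀ {x} → x ∈ xs → key x ∈ ks) → (∀ k → count (λ x → key x ≟ k) xs ≤ d) →
    length xs ≤ length ks * d
  length≤fibres _≟_ key d []       {[]}     u keys fib = z≤n
  length≤fibres _≟_ key d []       {x ∷ xs} u keys fib with () ← keys (here refl)
  length≤fibres _≟_ key d (k ∷ ks) {xs}     u keys fib = begin
    length xs                                 ≡⟨ length≡count+count¬ at-k? xs ⟩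
    count at-k? xs + count (¬? ∘ at-k?) xs    ≤⟨ +-mono-≤ (fib k) rest ⟩
    d + length ks * d                         ∎
    where
    open ≤-Reasoning
    at-k? : Decidable (λ x → key x ≡ k)
    at-k? x = key x ≟ k
    keys′ : ∀ {x} → x ∈ filter (¬? ∘ at-k?) xs → key x ∈ ks
    keys′ x∈ with x∈xs , x≢k ← ∈-filter⁻ (¬? ∘ at-k?) {xs = xs} x∈ with keys x∈xs
    ... | here eq  = contradiction eq x≢k
    ... | there k∈ = k∈
    rest : count (¬? ∘ at-k?) xs ≤ length ks * d
    rest = length≤fibres _≟_ key d ks (filter⁺ (¬? ∘ at-k?) u) keys′
      (λ k′ → ≤-trans (count-mono (λ x → key x ≟ k′) (λ x → key x ≟ k′) (filter⁺ (¬? ∘ at-k?) u)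
                        (λ x∈ e → proj₁ (∈-filter⁻ (¬? ∘ at-k?) {xs = xs} x∈) , e)) (fib k′))

  /-%-injective : ∀ m n k .{{_ : NonZero k}} → m / k ≡ n / k → m % k ≡ n % k → m ≡ n
  /-%-injective m n k eq/ eq% = trans (m≡m%n+[m/n]*n m k)
    (trans (cong₂ (λ r s → r + s * k) eq% eq/) (sym (m≡m%n+[m/n]*n n k)))

  -- The edges are chopped into L groups of at most |cs| each; in the bipartite graph joining keys to
  -- groups a proper colouring uses every colour at most once per group.
  spread : {E K C : Set} (_≟E_ : DecidableEquality E) (_≟K_ : DecidableEquality K) (_≟C_ : DecidableEquality C)
    (key : E → K) (L : ℕ) (cs : List C) → Unique cs → (R : List E) → Unique R →
    length R ≤ L * length cs → (∀ u → count (λ e → key e ≟K u) R ≤ length cs) → (E → C) →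
    Σ (E → C) λ f → (∀ {e} → e ∈ R → f e ∈ cs)
         × (∀ {e e′} → e ∈ R → e′ ∈ R → key e ≡ key e′ → f e ≡ f e′ → e ≡ e′)
         × (∀ z → count (λ e → f e ≟C z) R ≤ L)
  spread _≟E_ _≟K_ _≟C_ key L []          ucs []      uR len deg f₀ = f₀ , (λ ()) , (λ ()) , λ _ → z≤n
  spread _≟E_ _≟K_ _≟C_ key L []          ucs (e ∷ R) uR len deg f₀ =
    contradiction (subst (length (e ∷ R) ≤_) (*-zeroʳ L) len) λ ()
  spread {E} {K} {C} _≟E_ _≟K_ _≟C_ key L cs@(_ ∷ _) ucs R uR len deg f₀ = f , f∈ , f-inj , load
    where
    m : ℕ
    m = length cs
    group : E → ℕ
    group e = position _≟E_ R e / m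
    open BipartiteMultigraph _≟E_ _≟K_ _≟ℕ_ key group
    -- Within a group the remainder modulo `m` determines the position, so a group has at most `m`
    -- edges.
    group-size : ∀ v → degQ R v ≤ m
    group-size v = subst (degQ R v ≤_) (length-upTo m)
      (injection⇒length≤ {ys = upTo m} (λ e → position _≟E_ R e % m) (filter⁺ in-group? uR)
        (λ {e} {e′} e∈ e′∈ eq → position-injective _≟E_ (proj₁ (member e∈)) (proj₁ (member e′∈))
          (/-%-injective _ _ m (trans (proj₂ (member e∈)) (sym (proj₂ (member e′∈)))) eq))
        (λ {e} _ → ∈-upTo⁺ (m%n<n (position _≟E_ R e) m)))
      where
      in-group? : Decidable (λ e → group e ≡ v)
      in-group? e = group e ≟ℕ v
      member : ∀ {e} → e ∈ filter in-group? R → e ∈ R × group e ≡ v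
      member = ∈-filter⁻ in-group? {xs = R}
    colouring : Σ (E → C) λ c → Proper R c × (∀ {e} → e ∈ R → c e ∈ cs)
    colouring = könig _≟C_ cs ucs R deg group-size f₀
    f : E → C
    f = proj₁ colouring
    f∈ : ∀ {e} → e ∈ R → f e ∈ cs
    f∈ = proj₂ (proj₂ colouring)
    f-inj : ∀ {e e′} → e ∈ R → e′ ∈ R → key e ≡ key e′ → f e ≡ f e′ → e ≡ e′
    f-inj e∈ e′∈ eq = proj₁ (proj₂ colouring) e∈ e′∈ (inj₁ eq)
    -- Equally coloured edges lie in different groups, and positions below `L * m` fall into `L`
    -- groups.
    load : ∀ z → count (λ e → f e ≟C z) R ≤ L
    load z = subst (count (λ e → f e ≟C z) R ≤_) (length-upTo L)
      (injection⇒length≤ {ys = upTo L} group (filter⁺ (λ e → f e ≟C z) uR)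
        (λ e∈ e′∈ eq → proj₁ (proj₂ colouring) (proj₁ (member e∈)) (proj₁ (member e′∈)) (inj₂ eq)
          (trans (proj₂ (member e∈)) (sym (proj₂ (member e′∈)))))
        (λ e∈ → ∈-upTo⁺ (m<n*o⇒m/o<n {n = L} (<-≤-trans (position< _≟E_ (proj₁ (member e∈))) len))))
      where
      member : ∀ {e} → e ∈ filter (λ e → f e ≟C z) R → e ∈ R × f e ≡ z
      member = ∈-filter⁻ (λ e → f e ≟C z) {xs = R}

  -- Routing through two halves of B.

  module Routing {E X Y : Set} (_≟E_ : DecidableEquality E) (_≟X_ : DecidableEquality X) (_≟Y_ : DecidableEquality Y)
    (x : E → X) (y : E → Y) (R : List E) (uR : Unique R) where

    xdeg : X → ℕ
    xdeg u = count (λ e → x e ≟X u) R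

    ydeg : Y → ℕ
    ydeg z = count (λ e → y e ≟Y z) R

    at : List Y → List E
    at B = filter (λ e → mem? _≟Y_ (y e) B) R

    -- The demand e is routed along x e , f e , g e , y e.
    record Routes : Set where
      field
        f : E → Y
        g : E → X
        f≢y : ∀ {e} → e ∈ R → f e ≢ y e
        x-f-f : ∀ {e e′} → e ∈ R → e′ ∈ R → x e ≡ x e′ → f e ≡ f e′ → e ≡ e′
        -- With `e` and `e′` equal, this also separates `x e` from `g e`.
        x-g-f : ∀ {e e′} → e ∈ R → e′ ∈ R → x e ≡ g e′ → f e ≢ f e′
        x-g-y : ∀ {e e′} → e ∈ R → e′ ∈ R → x e ≡ g e′ → f e ≢ y e′
        g-proper : ∀ {e e′} → e ∈ R → e′ ∈ R → (f e ≡ f e′ ⊎ f e ≡ y e′ ⊎ y e ≡ y e′) → g e ≡ g e′ → e ≡ e′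

    -- The bounds on `xdeg` and on `length (at B)` are what `spread` needs to distribute the demands
    -- ending in one half over the other. `room` says that a list stays at least as long as the
    -- maximum degree `d + L` after `L + L` forbidden colours are removed.
    module TwoHalves (as : List X) (B₁ B₂ : List Y) (L d : ℕ) (uas : Unique as) (uB₁ : Unique B₁) (uB₂ : Unique B₂)
      (disjoint : ∀ {z} → z ∈ B₁ → z ∉ B₂) (cover : ∀ {e} → e ∈ R → y e ∈ B₁ ⊎ y e ∈ B₂)
      (xdeg≤₁ : ∀ u → xdeg u ≤ length B₁) (xdeg≤₂ : ∀ u → xdeg u ≤ length B₂) (ydeg≤ : ∀ z → ydeg z ≤ d)
      (len₁ : length (at B₁) ≤ L * length B₂) (len₂ : length (at B₂) ≤ L * length B₁)
      (room : (d + L) + (L + L) ≤ length as) where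

      half : ∀ B B′ → Unique B′ → length (at B) ≤ L * length B′ → (∀ u → xdeg u ≤ length B′) →
        Σ (E → Y) λ f → (∀ {e} → e ∈ at B → f e ∈ B′)
         × (∀ {e e′} → e ∈ at B → e′ ∈ at B → x e ≡ x e′ → f e ≡ f e′ → e ≡ e′)
         × (∀ z → count (λ e → f e ≟Y z) (at B) ≤ L)
      half B B′ uB′ len deg = spread _≟E_ _≟X_ _≟Y_ x L B′ uB′ (at B)
        (filter⁺ (λ e → mem? _≟Y_ (y e) B) uR) len
        (λ u → ≤-trans (count-mono (λ e → x e ≟X u) (λ e → x e ≟X u) (filter⁺ (λ e → mem? _≟Y_ (y e) B) uR)
                          (λ e∈ eq → proj₁ (∈-filter⁻ (λ e → mem? _≟Y_ (y e) B) {xs = R} e∈) , eq)) (deg u)) y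

      half₁ = half B₁ B₂ uB₂ len₁ xdeg≤₂
      half₂ = half B₂ B₁ uB₁ len₂ xdeg≤₁
      f₁ f₂ : E → Y
      f₁ = proj₁ half₁
      f₂ = proj₁ half₂

      at⁺ : ∀ {B e} → e ∈ R → y e ∈ B → e ∈ at B
      at⁺ {B} = ∈-filter⁺ (λ e → mem? _≟Y_ (y e) B)

      y∈₁? : ∀ e → Dec (y e ∈ B₁)
      y∈₁? e = mem? _≟Y_ (y e) B₁

      y∈₂ : ∀ {e} → e ∈ R → y e ∉ B₁ → y e ∈ B₂
      y∈₂ e∈ y∉ with cover e∈
      ... | inj₁ y∈ = contradiction y∈ y∉
      ... | inj₂ y∈ = y∈

      -- `p e` and `q e` are the ends in `B₁` and in `B₂` of the pair formed by `f e` and `y e`. The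
      -- two halves thus make the multigraph of these pairs bipartite, as Galvin's theorem requires.
      f p q : E → Y
      f e with y∈₁? e
      ... | yes _ = f₁ e
      ... | no  _ = f₂ e
      p e with y∈₁? e
      ... | yes _ = y e
      ... | no  _ = f₂ e
      q e with y∈₁? e
      ... | yes _ = f₁ e
      ... | no  _ = y e

      f₁∈ : ∀ {e} → e ∈ R → y e ∈ B₁ → f₁ e ∈ B₂
      f₁∈ e∈ y∈ = proj₁ (proj₂ half₁) (at⁺ e∈ y∈)

      f₂∈ : ∀ {e} → e ∈ R → y e ∉ B₁ → f₂ e ∈ B₁
      f₂∈ e∈ y∉ = proj₁ (proj₂ half₂) (at⁺ e∈ (y∈₂ e∈ y∉))

      apart : ∀ {z z′} → z ∈ B₁ → z′ ∈ B₂ → z ≢ z′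
      apart z∈ z∈′ refl = disjoint z∈ z∈′

      f-inj : ∀ {e e′} → e ∈ R → e′ ∈ R → x e ≡ x e′ → f e ≡ f e′ → e ≡ e′
      f-inj {e} {e′} e∈ e′∈ ex ef with y∈₁? e | y∈₁? e′
      ... | yes y∈ | yes y∈′ = proj₁ (proj₂ (proj₂ half₁)) (at⁺ e∈ y∈) (at⁺ e′∈ y∈′) ex ef
      ... | no  y∉ | no  y∉′ =
        proj₁ (proj₂ (proj₂ half₂)) (at⁺ e∈ (y∈₂ e∈ y∉)) (at⁺ e′∈ (y∈₂ e′∈ y∉′)) ex ef
      ... | yes y∈ | no  y∉′ = contradiction (sym ef) (apart (f₂∈ e′∈ y∉′) (f₁∈ e∈ y∈))
      ... | no  y∉ | yes y∈′ = contradiction ef (apart (f₂∈ e∈ y∉) (f₁∈ e′∈ y∈′))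

      -- A vertex of `B₁` is an `f`-value only of demands ending in `B₂`, and conversely. So just
      -- one of the two spreadings contributes at each vertex, and the load is `L` instead of
      -- `L + L`.
      load : ∀ z → count (λ e → f e ≟Y z) R ≤ L
      load z with mem? _≟Y_ z B₁
      ... | yes z∈ = ≤-trans (count-mono (λ e → f e ≟Y z) (λ e → f₂ e ≟Y z) uR into) (proj₂ (proj₂ (proj₂ half₂)) z)
        where
        into : ∀ {e} → e ∈ R → f e ≡ z → e ∈ at B₂ × f₂ e ≡ z
        into {e} e∈ eq with y∈₁? e
        ... | no  y∉ = at⁺ e∈ (y∈₂ e∈ y∉) , eq
        ... | yes y∈ = contradiction (sym eq) (apart z∈ (f₁∈ e∈ y∈))
      ... | no z∉ = ≤-trans (count-mono (λ e → f e ≟Y z) (λ e → f₁ e ≟Y z) uR into) (proj₂ (proj₂ (proj₂ half₁)) z)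
        where
        into : ∀ {e} → e ∈ R → f e ≡ z → e ∈ at B₁ × f₁ e ≡ z
        into {e} e∈ eq with y∈₁? e
        ... | yes y∈ = at⁺ e∈ y∈ , eq
        ... | no  y∉ = contradiction (subst (_∈ B₁) eq (f₂∈ e∈ y∉)) z∉

      open BipartiteMultigraph _≟E_ _≟Y_ _≟Y_ p q

      -- Coinciding ends lie in the same half, hence on the same side of the multigraph;
      -- disjointness of the halves excludes the remaining combinations.
      adjacent : ∀ {e e′} → e ∈ R → e′ ∈ R → (f e ≡ f e′ ⊎ f e ≡ y e′ ⊎ y e ≡ y e′) → Adjacent e e′
      adjacent {e} {e′} e∈ e′∈ share with y∈₁? e | y∈₁? e′
      ... | yes y∈ | yes y∈′ with share
      ...   | inj₁ eq        = inj₂ eq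
      ...   | inj₂ (inj₁ eq) = contradiction (sym eq) (apart y∈′ (f₁∈ e∈ y∈))
      ...   | inj₂ (inj₂ eq) = inj₁ eq
      adjacent {e} {e′} e∈ e′∈ share | no  y∉ | no  y∉′ with share
      ...   | inj₁ eq        = inj₁ eq
      ...   | inj₂ (inj₁ eq) = contradiction (subst (_∈ B₁) eq (f₂∈ e∈ y∉)) y∉′
      ...   | inj₂ (inj₂ eq) = inj₂ eq
      adjacent {e} {e′} e∈ e′∈ share | yes y∈ | no  y∉′ with share
      ...   | inj₁ eq        = contradiction (sym eq) (apart (f₂∈ e′∈ y∉′) (f₁∈ e∈ y∈))
      ...   | inj₂ (inj₁ eq) = inj₂ eq
      ...   | inj₂ (inj₂ eq) = contradiction (subst (_∈ B₁) eq y∈) y∉′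
      adjacent {e} {e′} e∈ e′∈ share | no  y∉ | yes y∈′ with share
      ...   | inj₁ eq        = contradiction eq (apart (f₂∈ e∈ y∉) (f₁∈ e′∈ y∈′))
      ...   | inj₂ (inj₁ eq) = inj₁ eq
      ...   | inj₂ (inj₂ eq) = contradiction (subst (_∈ B₁) (sym eq) y∈′) y∉

      p-incident : ∀ {e u} → p e ≡ u → y e ≡ u ⊎ f e ≡ u
      p-incident {e} eq with y∈₁? e
      ... | yes _ = inj₁ eq
      ... | no  _ = inj₂ eq

      q-incident : ∀ {e u} → q e ≡ u → y e ≡ u ⊎ f e ≡ u
      q-incident {e} eq with y∈₁? e
      ... | yes _ = inj₂ eq
      ... | no  _ = inj₁ eq

      degP≤ : ∀ u → degP R u ≤ d + L
      degP≤ u = ≤-trans (count-∪ (λ e → p e ≟Y u) (λ e → y e ≟Y u) (λ e → f e ≟Y u) p-incident uR)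
                        (+-mono-≤ (ydeg≤ u) (load u))

      degQ≤ : ∀ u → degQ R u ≤ d + L
      degQ≤ u = ≤-trans (count-∪ (λ e → q e ≟Y u) (λ e → y e ≟Y u) (λ e → f e ≟Y u) q-incident uR)
                        (+-mono-≤ (ydeg≤ u) (load u))

      -- The vertices of A whose edge to `z` is already taken as the first edge of some path.
      users : Y → List X
      users z = map x (filter (λ e → f e ≟Y z) R)

      ∈-users : ∀ {e z} → e ∈ R → f e ≡ z → x e ∈ users z
      ∈-users {z = z} e∈ eq = ∈-map⁺ x (∈-filter⁺ (λ e → f e ≟Y z) e∈ eq)

      Allowed : E → X → Set
      Allowed e u = u ∉ users (f e) ++ users (y e)

      allowed? : ∀ e → Decidable (Allowed e)
      allowed? e u = ¬? (mem? _≟X_ u (users (f e) ++ users (y e)))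

      enough : ∀ {e} → d + L ≤ count (allowed? e) as
      enough {e} = +-cancelʳ-≤ (L + L) (d + L) _ (begin
        (d + L) + (L + L)                                               ≤⟨ room ⟩
        length as                                                       ≡⟨ length≡count+count¬ (allowed? e) as ⟩
        count (allowed? e) as + count (λ u → ¬? (allowed? e u)) as      ≤⟨ +-monoʳ-≤ (count (allowed? e) as) few ⟩
        count (allowed? e) as + (L + L)                                 ∎)
        where
        open ≤-Reasoning
        users≤ : ∀ z → length (users z) ≤ L
        users≤ z = subst (_≤ L) (sym (length-map x (filter (λ e → f e ≟Y z) R))) (load z)
        forbidden : filter (λ u → ¬? (allowed? e u)) as ⊆ users (f e) ++ users (y e)
        forbidden u∈ = decidable-stable (mem? _≟X_ _ _) (proj₂ (∈-filter⁻ (λ u → ¬? (allowed? e u)) {xs = as} u∈))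
        few : count (λ u → ¬? (allowed? e u)) as ≤ L + L
        few = begin
          count (λ u → ¬? (allowed? e u)) as             ≤⟨ Unique-⊆⇒length≤ (filter⁺ (λ u → ¬? (allowed? e u)) uas) forbidden ⟩
          length (users (f e) ++ users (y e))            ≡⟨ length-++ (users (f e)) ⟩
          length (users (f e)) + length (users (y e))    ≤⟨ +-mono-≤ (users≤ (f e)) (users≤ (y e)) ⟩
          L + L                                          ∎

      routes : Routes
      routes with g , proper , allowed ←
          galvin _≟E_ _≟Y_ _≟Y_ p q Allowed allowed? (d + L) as uas R uR degP≤ degQ≤ (λ _ → enough) x = record
        { f = f
        ; g = g
        ; f≢y = f≢y
        ; x-f-f = f-inj
        ; x-g-f = λ {e} {e′} e∈ e′∈ ex ef → proj₂ (allowed e′∈) (∈-++⁺ˡ (subst (_∈ users (f e′)) ex (∈-users e∈ ef)))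
        ; x-g-y = λ {e} {e′} e∈ e′∈ ex ef → proj₂ (allowed e′∈)
                    (∈-++⁺ʳ (users (f e′)) (subst (_∈ users (y e′)) ex (∈-users e∈ ef)))
        ; g-proper = λ e∈ e′∈ share → proper e∈ e′∈ (adjacent e∈ e′∈ share)
        }
        where
        f≢y : ∀ {e} → e ∈ R → f e ≢ y e
        f≢y {e} e∈ eq with y∈₁? e
        ... | yes y∈ = apart y∈ (f₁∈ e∈ y∈) (sym eq)
        ... | no  y∉ = y∉ (subst (_∈ B₁) eq (f₂∈ e∈ y∉))

  -- Halving a list and rounding quarters.

  -- The middle element is kept apart because the half that it joins is decided only later; the
  -- bounds leave the halves nearly equal either way.
  split-middle : {X : Set} (xs : List X) → 0 < length xs →
    ∃[ ys ] ∃[ z ] ∃[ zs ] xs ≡ ys ++ z ∷ zs × length ys ≤ suc (length zs) × length zs ≤ length ys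
  split-middle xs nonempty with split-at k xs k<
    where
    k = length xs / 2
    k< : k < length xs
    k< = m<n*o⇒m/o<n (subst (length xs <_) (*-comm 2 (length xs)) (m<m+n (length xs) (subst (0 <_) (sym (+-identityʳ _)) nonempty)))
  ... | ys , z , zs , refl , len = ys , z , zs , refl , lower , upper
    where
    n = length (ys ++ z ∷ zs)
    parity : length ys + suc (length zs) ≡ n % 2 + length ys * 2
    parity = begin-equality
      length ys + suc (length zs)   ≡⟨ length-++ ys ⟨
      n                             ≡⟨ m≡m%n+[m/n]*n n 2 ⟩
      n % 2 + n / 2 * 2             ≡⟨ cong (λ k → n % 2 + k * 2) len ⟨
      n % 2 + length ys * 2         ∎
      where open ≤-Reasoning
    parity′ : suc (length zs) ≡ n % 2 + length ys
    parity′ = +-cancelˡ-≡ (length ys) _ _ (trans parity (shuffle (n % 2) (length ys)))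
      where
      shuffle : ∀ r k → r + k * 2 ≡ k + (r + k)
      shuffle = solve-∀
    lower : length ys ≤ suc (length zs)
    lower = subst (length ys ≤_) (sym parity′) (m≤n+m (length ys) (n % 2))
    upper : length zs ≤ length ys
    upper = s≤s⁻¹ (subst (_≤ suc (length ys)) (sym parity′) (+-monoˡ-≤ (length ys) (s≤s⁻¹ (m%n<n n 2))))

  -- L is a/4 rounded up, d is (a − 9)/4 rounded down.
  quarters : ∀ a → 9 ≤ a →
    ∃[ L ] ∃[ d ] a ≤ L * 4 × d ≤ L × (d + L) + (L + L) ≤ a × (∀ k → k * 4 + 9 ≤ a → k ≤ d)
  quarters a 9≤a = L , d , a≤4L , d≤L , room , below
    where
    open ≤-Reasoning
    L d : ℕ
    L = (a + 3) / 4
    d = (a ∸ 9) / 4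
    4L≤ : L * 4 ≤ a + 3
    4L≤ = m/n*n≤m (a + 3) 4
    4d≤ : d * 4 + 9 ≤ a
    4d≤ = begin
      d * 4 + 9     ≤⟨ +-monoˡ-≤ 9 (m/n*n≤m (a ∸ 9) 4) ⟩
      a ∸ 9 + 9     ≡⟨ m∸n+n≡m 9≤a ⟩
      a             ∎
    a≤4L : a ≤ L * 4
    a≤4L = +-cancelʳ-≤ 3 a (L * 4) (begin
      a + 3                       ≡⟨ m≡m%n+[m/n]*n (a + 3) 4 ⟩
      (a + 3) % 4 + L * 4         ≤⟨ +-monoˡ-≤ (L * 4) (s≤s⁻¹ (m%n<n (a + 3) 4)) ⟩
      3 + L * 4                   ≡⟨ +-comm 3 (L * 4) ⟩
      L * 4 + 3                   ∎)
    d≤L : d ≤ L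
    d≤L = /-monoˡ-≤ 4 (≤-trans (m∸n≤m a 9) (m≤m+n a 3))
    -- This is where the constant 9 comes from: each of the three copies of `L` exceeds `a / 4` by
    -- at most 3/4, and the 9/4 taken off in `d` pays for them.
    room : (d + L) + (L + L) ≤ a
    room = *-cancelʳ-≤ _ _ 4 (+-cancelʳ-≤ 9 _ _ (begin
      ((d + L) + (L + L)) * 4 + 9                     ≡⟨ expand d L ⟩
      (d * 4 + 9) + (L * 4 + (L * 4 + L * 4))         ≤⟨ +-mono-≤ 4d≤ (+-mono-≤ 4L≤ (+-mono-≤ 4L≤ 4L≤)) ⟩
      a + ((a + 3) + ((a + 3) + (a + 3)))             ≡⟨ collect a ⟩
      a * 4 + 9                                       ∎))
      where
      expand : ∀ d L → ((d + L) + (L + L)) * 4 + 9 ≡ (d * 4 + 9) + (L * 4 + (L * 4 + L * 4))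
      expand = solve-∀
      collect : ∀ a → a + ((a + 3) + ((a + 3) + (a + 3))) ≡ a * 4 + 9
      collect = solve-∀
    below : ∀ k → k * 4 + 9 ≤ a → k ≤ d
    below k le = subst (_≤ d) (m*n/n≡m k 4) (/-monoˡ-≤ 4 (m+n≤o⇒m≤o∸n (k * 4) le))

  -- A degree below a quarter of `length bs` fits even into the shorter part `zs`, which is about
  -- half of `bs`. Degrees at A therefore suit either choice of halves.
  ≤-half : ∀ {k s} x → x * 4 + 9 ≤ k + suc s → k ≤ suc s → x ≤ s
  ≤-half {k} {s} x le k≤ = *-cancelʳ-≤ x s 2 (+-cancelʳ-≤ 9 (x * 2) (s * 2) (begin
    x * 2 + 9           ≤⟨ +-monoˡ-≤ 9 (*-monoʳ-≤ x (s≤s (s≤s z≤n))) ⟩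
    x * 4 + 9           ≤⟨ le ⟩
    k + suc s           ≤⟨ +-monoˡ-≤ (suc s) k≤ ⟩
    suc s + suc s       ≡⟨ twice s ⟩
    s * 2 + 2           ≤⟨ +-monoʳ-≤ (s * 2) (s≤s (s≤s z≤n)) ⟩
    s * 2 + 9           ∎))
    where
    open ≤-Reasoning
    twice : ∀ s → suc s + suc s ≡ s * 2 + 2
    twice = solve-∀

  -- Balancing the two halves.

  module _ {E X Y : Set} (_≟E_ : DecidableEquality E) (_≟X_ : DecidableEquality X) (_≟Y_ : DecidableEquality Y)
    (x : E → X) (y : E → Y) (R : List E) (uR : Unique R) where

    open Routing _≟E_ _≟X_ _≟Y_ x y R uR

    module _ (as : List X) (bs : List Y) (uas : Unique as) (ubs : Unique bs)
      (x∈ : ∀ {e} → e ∈ R → x e ∈ as) (y∈ : ∀ {e} → e ∈ R → y e ∈ bs)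
      (xdeg≤ : ∀ u → xdeg u * 4 + 9 ≤ length bs) (ydeg≤ : ∀ z → ydeg z * 4 + 9 ≤ length as)
      (9≤as : 9 ≤ length as) (9≤bs : 9 ≤ length bs) where

      open ≤-Reasoning

      at? : ∀ B e → Dec (y e ∈ B)
      at? B e = mem? _≟Y_ (y e) B

      length-at≤ : ∀ d B → (∀ z → ydeg z ≤ d) → length (at B) ≤ length B * d
      length-at≤ d B deg = length≤fibres _≟Y_ y d B (filter⁺ (at? B) uR)
        (λ e∈ → proj₂ (∈-filter⁻ (at? B) {xs = R} e∈))
        (λ z → ≤-trans (count-mono (λ e → y e ≟Y z) (λ e → y e ≟Y z) (filter⁺ (at? B) uR)
                          (λ e∈ eq → proj₁ (∈-filter⁻ (at? B) {xs = R} e∈) , eq)) (deg z))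

      -- Demands are counted from the A-side: at most `L * 4` vertices, each with at most a quarter
      -- of `length bs ∸ 9`. The shortfall against `L * length bs` later pays for moving the middle
      -- vertex.
      total≤ : ∀ L → length as ≤ L * 4 → length R ≤ L * (length bs ∸ 9)
      total≤ L as≤ = *-cancelʳ-≤ _ _ 4 (begin
        length R * 4                      ≤⟨ *-monoˡ-≤ 4 (length≤fibres _≟X_ x dX as uR x∈ xdeg≤dX) ⟩
        length as * dX * 4                ≡⟨ *-assoc (length as) dX 4 ⟩
        length as * (dX * 4)              ≤⟨ *-mono-≤ as≤ (m/n*n≤m (length bs ∸ 9) 4) ⟩
        L * 4 * (length bs ∸ 9)           ≡⟨ swap L (length bs ∸ 9) ⟩
        L * (length bs ∸ 9) * 4           ∎)
        where
        dX : ℕ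
        dX = (length bs ∸ 9) / 4
        xdeg≤dX : ∀ u → xdeg u ≤ dX
        xdeg≤dX u = subst (_≤ dX) (m*n/n≡m (xdeg u) 4) (/-monoˡ-≤ 4 (m+n≤o⇒m≤o∸n (xdeg u * 4) (xdeg≤ u)))
        swap : ∀ L n → L * 4 * n ≡ L * n * 4
        swap = solve-∀

      -- When the middle vertex z cannot join the second half, the first half carries so few demands that z
      -- can join it.
      routing : Routes
      routing with quarters (length as) 9≤as | split-middle bs (≤-trans (s≤s z≤n) 9≤bs)
      ... | L , d , as≤4L , d≤L , room , below | ys , z , zs , refl , k≤ , s≤ = choose (length (at (z ∷ zs)) ≤? L * k)
        where
        k s : ℕ
        k = length ys
        s = length zs

        bs-length : length (ys ++ z ∷ zs) ≡ k + suc s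
        bs-length = length-++ ys

        ydeg≤d : ∀ v → ydeg v ≤ d
        ydeg≤d v = below (ydeg v) (ydeg≤ v)

        xdeg≤s : ∀ u → xdeg u ≤ s
        xdeg≤s u = ≤-half (xdeg u) (subst (xdeg u * 4 + 9 ≤_) bs-length (xdeg≤ u)) k≤

        uys : Unique ys
        uys = proj₁ (Unique-++⁻ ys ubs)
        uzzs : Unique (z ∷ zs)
        uzzs = proj₁ (proj₂ (Unique-++⁻ ys ubs))
        ys#zzs : ∀ {v} → v ∈ ys → v ∉ z ∷ zs
        ys#zzs = proj₂ (proj₂ (Unique-++⁻ ys ubs))

        at-small : ∀ B n → length B ≤ n → length (at B) ≤ L * n
        at-small B n B≤ = begin
          length (at B)        ≤⟨ length-at≤ d B ydeg≤d ⟩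
          length B * d         ≤⟨ *-mono-≤ B≤ d≤L ⟩
          n * L                ≡⟨ *-comm n L ⟩
          L * n                ∎

        at-disjoint : length (at ys) + length (at (z ∷ zs)) ≤ length R
        at-disjoint = begin
          length (at ys) + length (at (z ∷ zs))                ≤⟨ +-monoʳ-≤ (length (at ys)) elsewhere ⟩
          length (at ys) + count (λ e → ¬? (at? ys e)) R       ≡⟨ length≡count+count¬ (at? ys) R ⟨
          length R                                             ∎
          where
          elsewhere : length (at (z ∷ zs)) ≤ count (λ e → ¬? (at? ys e)) R
          elsewhere = count-mono (at? (z ∷ zs)) (λ e → ¬? (at? ys e)) uR λ e∈ i → e∈ , λ j → ys#zzs j i

        at-cons : length (at (z ∷ ys)) ≤ d + length (at ys)
        at-cons = ≤-trans (count-∪ (at? (z ∷ ys)) (λ e → y e ≟Y z) (at? ys) uncons uR) (+-monoˡ-≤ _ (ydeg≤d z))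
          where
          uncons : ∀ {e} → y e ∈ z ∷ ys → y e ≡ z ⊎ y e ∈ ys
          uncons (here eq) = inj₁ eq
          uncons (there i) = inj₂ i

        total+L : length R + L ≤ L * (k + s)
        total+L = begin
          length R + L                            ≤⟨ +-monoˡ-≤ L (total≤ L as≤4L) ⟩
          L * (length (ys ++ z ∷ zs) ∸ 9) + L     ≡⟨ +-comm _ L ⟩
          L + L * (length (ys ++ z ∷ zs) ∸ 9)     ≡⟨ *-suc L _ ⟨
          L * suc (length (ys ++ z ∷ zs) ∸ 9)     ≤⟨ *-monoʳ-≤ L fewer ⟩
          L * (k + s)                             ∎
          where
          fewer : suc (length (ys ++ z ∷ zs) ∸ 9) ≤ k + s
          fewer = begin
            suc (length (ys ++ z ∷ zs) ∸ 9)    ≡⟨ cong (λ n → suc (n ∸ 9)) bs-length ⟩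
            suc (k + suc s ∸ 9)                ≡⟨ cong (λ n → suc (n ∸ 9)) (+-suc k s) ⟩
            suc (k + s ∸ 8)                    ≤⟨ +-monoˡ-≤ (k + s ∸ 8) (s≤s z≤n) ⟩
            8 + (k + s ∸ 8)                    ≡⟨ m+[n∸m]≡n 8≤ ⟩
            k + s                              ∎
            where
            8≤ : 8 ≤ k + s
            8≤ = s≤s⁻¹ (subst (9 ≤_) (trans bs-length (+-suc k s)) 9≤bs)

        choose : Dec (length (at (z ∷ zs)) ≤ L * k) → Routes
        choose (yes fits) = TwoHalves.routes as ys (z ∷ zs) L d uas uys uzzs ys#zzs
          (λ e∈ → ∈-++⁻ ys (y∈ e∈))
          (λ u → ≤-trans (xdeg≤s u) s≤) (λ u → ≤-trans (xdeg≤s u) (n≤1+n s)) ydeg≤d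
          (at-small ys (suc s) k≤) fits room
        choose (no overfull) = TwoHalves.routes as (z ∷ ys) zs L d uas (¬Any⇒All¬ _ (λ i → ys#zzs i (here refl)) ∷ uys)
          (tail uzzs) disjoint cover
          (λ u → ≤-trans (xdeg≤s u) (≤-trans s≤ (n≤1+n k))) xdeg≤s ydeg≤d
          first (at-small zs (suc k) (≤-trans s≤ (n≤1+n k))) room
          where
          disjoint : ∀ {v} → v ∈ z ∷ ys → v ∉ zs
          disjoint (here refl) j = Unique[x∷xs]⇒x∉xs uzzs j
          disjoint (there i)   j = ys#zzs i (there j)
          cover : ∀ {e} → e ∈ R → y e ∈ z ∷ ys ⊎ y e ∈ zs
          cover e∈ with ∈-++⁻ ys (y∈ e∈)
          ... | inj₁ i         = inj₁ (there i)
          ... | inj₂ (here eq) = inj₁ (here eq)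
          ... | inj₂ (there i) = inj₂ i
          -- The left-hand sum counts the demands at `z` twice, at a cost of at most `d`, which the
          -- slack in `total+L` covers. Since the overfull half already accounts for `L * k`, only
          -- `L * s` remains for the other.
          first : length (at (z ∷ ys)) ≤ L * s
          first = +-cancelˡ-≤ (L * k) _ _ (begin
            L * k + length (at (z ∷ ys))                        ≤⟨ +-mono-≤ (<⇒≤ (≰⇒> overfull)) at-cons ⟩
            length (at (z ∷ zs)) + (d + length (at ys))         ≡⟨ rearrange (length (at (z ∷ zs))) d (length (at ys)) ⟩
            length (at ys) + length (at (z ∷ zs)) + d           ≤⟨ +-mono-≤ at-disjoint d≤L ⟩
            length R + L                                        ≤⟨ total+L ⟩
            L * (k + s)                                         ≡⟨ *-distribˡ-+ L k s ⟩
            L * k + L * s                                       ∎)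
            where
            rearrange : ∀ g d f → g + (d + f) ≡ f + g + d
            rearrange = solve-∀

  -- From routes to edge-disjoint paths.

  module _ {a b : ℕ} (D : Demand a b) where

    private
      E : Set
      E = Fin (length D)
      x : E → Fin a
      x i = proj₁ (lookup D i)
      y : E → Fin b
      y i = proj₂ (lookup D i)

    open Routing _≟F_ _≟F_ _≟F_ x y (allFin (length D)) (allFin⁺ (length D)) using (Routes)

    routes⇒resolvable : Routes → Resolvable D
    routes⇒resolvable r = path , is-path , disjoint
      where
      open Routing.Routes r
      path : E → List (V a b)
      path i = inj₁ (x i) ∷ inj₂ (f i) ∷ inj₁ (g i) ∷ inj₂ (y i) ∷ []

      is-path : ∀ i → IsPathK (inj₁ (x i)) (inj₂ (y i)) (path i)
      is-path i = refl , refl , (tt , tt , tt , tt)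
        , ((λ ()) ∷ x≢g ∷ (λ ()) ∷ []) ∷ ((λ ()) ∷ f≢y′ ∷ []) ∷ ((λ ()) ∷ []) ∷ [] ∷ []
        where
        x≢g : inj₁ (x i) ≢ inj₁ (g i)
        x≢g eq with xg ← inj₁-injective eq = x-g-f (∈-allFin i) (∈-allFin i) xg refl
        f≢y′ : inj₂ (f i) ≢ inj₂ (y i)
        f≢y′ eq = f≢y (∈-allFin i) (inj₂-injective eq)

      -- The three edges of a path, each recorded from its A-end to its B-end, so that edges can be
      -- compared regardless of the direction of travel.
      data Uses (i : E) : Fin a → Fin b → Set where
        first  : Uses i (x i) (f i)
        middle : Uses i (g i) (f i)
        final  : Uses i (g i) (y i)

      uses-disjoint : ∀ {i j u u′ v v′} → Uses i u v → Uses j u′ v′ → u ≡ u′ → v ≡ v′ → i ≡ j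
      uses-disjoint {i} {j} p q eu ev with p | q
      ... | first  | first  = x-f-f (∈-allFin i) (∈-allFin j) eu ev
      ... | first  | middle = contradiction ev (x-g-f (∈-allFin i) (∈-allFin j) eu)
      ... | first  | final  = contradiction ev (x-g-y (∈-allFin i) (∈-allFin j) eu)
      ... | middle | first  = contradiction (sym ev) (x-g-f (∈-allFin j) (∈-allFin i) (sym eu))
      ... | final  | first  = contradiction (sym ev) (x-g-y (∈-allFin j) (∈-allFin i) (sym eu))
      ... | middle | middle = g-proper (∈-allFin i) (∈-allFin j) (inj₁ ev) eu
      ... | middle | final  = g-proper (∈-allFin i) (∈-allFin j) (inj₂ (inj₁ ev)) eu
      ... | final  | final  = g-proper (∈-allFin i) (∈-allFin j) (inj₂ (inj₂ ev)) eu
      ... | final  | middle = sym (g-proper (∈-allFin j) (∈-allFin i) (inj₂ (inj₁ (sym ev))) (sym eu))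

      data Edge (i : E) : V a b → V a b → Set where
        forward  : ∀ {u v} → Uses i u v → Edge i (inj₁ u) (inj₂ v)
        backward : ∀ {u v} → Uses i u v → Edge i (inj₂ v) (inj₁ u)

      reverse : ∀ {i s t} → Edge i s t → Edge i t s
      reverse (forward p)  = backward p
      reverse (backward p) = forward p

      edge : ∀ {i s t} → (s , t) ∈ steps (path i) → Edge i s t
      edge (here refl)                 = forward first
      edge (there (here refl))         = backward middle
      edge (there (there (here refl))) = forward final

      edges-disjoint : ∀ {i j s t} → Edge i s t → Edge j s t → i ≡ j
      edges-disjoint (forward p)  (forward q)  = uses-disjoint p q refl refl
      edges-disjoint (backward p) (backward q) = uses-disjoint p q refl refl

      disjoint : ∀ i j → i ≢ j → ¬ ShareEdge (path i) (path j)
      disjoint i j i≢j (_ , _ , p , inj₁ q) = i≢j (edges-disjoint (edge p) (edge q))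
      disjoint i j i≢j (_ , _ , p , inj₂ q) = i≢j (edges-disjoint (edge p) (reverse (edge q)))

    resolvable : (∀ u → degA D u * 4 + 9 ≤ b) → (∀ v → degB D v * 4 + 9 ≤ a) → 9 ≤ a → 9 ≤ b → Resolvable D
    resolvable dA dB 9≤a 9≤b = routes⇒resolvable
      (routing _≟F_ _≟F_ _≟F_ x y (allFin (length D)) (allFin⁺ (length D)) (allFin a) (allFin b) (allFin⁺ a) (allFin⁺ b)
        (λ _ → ∈-allFin _) (λ _ → ∈-allFin _)
        (λ u → subst₂ (λ m n → m * 4 + 9 ≤ n)
          (sym (trans (count-lookup (λ e → proj₁ e ≟F u) D) (count≡degA D u))) (sym (length-tabulate (λ (i : Fin b) → i))) (dA u))
        (λ v → subst₂ (λ m n → m * 4 + 9 ≤ n)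
          (sym (trans (count-lookup (λ e → proj₂ e ≟F v) D) (count≡degB D v))) (sym (length-tabulate (λ (i : Fin a) → i))) (dB v))
        (subst (9 ≤_) (sym (length-tabulate (λ (i : Fin a) → i))) 9≤a)
        (subst (9 ≤_) (sym (length-tabulate (λ (i : Fin b) → i))) 9≤b))

-- The error term and the rational degree bounds.

open import Data.Integer using (+_)
import Data.Integer as ℤ
import Data.Integer.Properties as ℤ
import Data.Integer.Tactic.RingSolver as ℤSolver
open import Data.Rational using (ℚ; 0ℚ; 1ℚ; _/_; _-_; _*_) renaming (_≤_ to _≤ℚ_; _<_ to _<ℚ_)
import Data.Rational as ℚ
import Data.Rational.Properties as ℚ
open import Data.Rational.Unnormalised as ℚᵘ using (mkℚᵘ; 1ℚᵘ)
import Data.Rational.Unnormalised.Properties as ℚᵘ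

-- The numerator 9 turns `(1ℚ - ε m) * (m / 4)` into `(m - 9) / 4`. At zero, where `9 / m` makes no
-- sense, the value 1 makes the factor vanish.
ε : ℕ → ℚ
ε zero    = 1ℚ
ε (suc m) = + 9 / suc m

0≤ε : ∀ m → 0ℚ ≤ℚ ε m
0≤ε zero    = ℚ.toℚᵘ-cancel-≤ (ℚᵘ.*≤* (ℤ.+≤+ z≤n))
0≤ε (suc m) = ℚ.toℚᵘ-cancel-≤ (ℚᵘ.≤-respʳ-≃ (ℚᵘ.≃-sym (ℚ.toℚᵘ-fromℚᵘ (mkℚᵘ (+ 9) m))) (ℚᵘ.*≤* (ℤ.+≤+ z≤n)))

ε→0 : ∀ δ → 0ℚ <ℚ δ → ∃[ M ] (∀ m → M ≤ m → ε m ≤ℚ δ)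
ε→0 (ℚ.mkℚ (+ zero) q _)  (ℚ.*<* (ℤ.+<+ ()))
-- A positive `δ` with denominator `suc q` is at least `1 / suc q`, and `9 / m` drops to that value
-- from `m = 9 * suc q` on.
ε→0 (ℚ.mkℚ (+ suc n) q c) _ = 9 ℕ.* suc q , λ where
    zero ()
    (suc m) le → ℚ.toℚᵘ-cancel-≤ (ℚᵘ.≤-respˡ-≃ (ℚᵘ.≃-sym (ℚ.toℚᵘ-fromℚᵘ (mkℚᵘ (+ 9) m)))
      (ℚᵘ.*≤* (subst₂ ℤ._≤_ (ℤ.pos-* 9 (suc q)) (ℤ.pos-* (suc n) (suc m))
        (ℤ.+≤+ (≤-trans le (m≤n*m (suc m) (suc n)))))))

-- For unnormalised rationals the order is a cross-multiplied inequality of integers, from which the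
-- factor `suc n`, left by the denominator of `ε`, is cancelled. Integers are used because
-- `suc n - 9` may be negative a priori.
degree-bound : ∀ k n → + k / 1 ≤ℚ (1ℚ - ε (suc n)) * (+ suc n / 4) → k ℕ.* 4 + 9 ≤ suc n
degree-bound k n le = ℤ.drop‿+≤+ (subst₂ ℤ._≤_ refl (plus-9 (+ suc n)) (ℤ.+-monoˡ-≤ (+ 9) cancelled))
  where
  open ℚᵘ.≤-Reasoning
  unnormalised : mkℚᵘ (+ k) 0 ℚᵘ.≤ (1ℚᵘ ℚᵘ.- mkℚᵘ (+ 9) n) ℚᵘ.* mkℚᵘ (+ suc n) 3
  unnormalised = begin
    mkℚᵘ (+ k) 0                                       ≃⟨ ℚ.toℚᵘ-fromℚᵘ (mkℚᵘ (+ k) 0) ⟨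
    ℚ.toℚᵘ (+ k / 1)                                   ≤⟨ ℚ.toℚᵘ-mono-≤ le ⟩
    ℚ.toℚᵘ ((1ℚ - ε (suc n)) * (+ suc n / 4))          ≃⟨ ℚ.toℚᵘ-homo-* (1ℚ - ε (suc n)) (+ suc n / 4) ⟩
    ℚ.toℚᵘ (1ℚ - ε (suc n)) ℚᵘ.* ℚ.toℚᵘ (+ suc n / 4)  ≃⟨ ℚᵘ.*-cong factor (ℚ.toℚᵘ-fromℚᵘ (mkℚᵘ (+ suc n) 3)) ⟩
    (1ℚᵘ ℚᵘ.- mkℚᵘ (+ 9) n) ℚᵘ.* mkℚᵘ (+ suc n) 3      ∎
    where
    factor : ℚ.toℚᵘ (1ℚ - ε (suc n)) ℚᵘ.≃ 1ℚᵘ ℚᵘ.- mkℚᵘ (+ 9) n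
    factor = ℚᵘ.≃-trans (ℚ.toℚᵘ-homo-+ 1ℚ (ℚ.- ε (suc n))) (ℚᵘ.+-congʳ 1ℚᵘ
      (ℚᵘ.≃-trans (ℚ.toℚᵘ-homo‿- (ε (suc n))) (ℚᵘ.-‿cong (ℚ.toℚᵘ-fromℚᵘ (mkℚᵘ (+ 9) n)))))
  cleared : + (k ℕ.* 4) ℤ.* + suc n ℤ.≤ (+ suc n ℤ.- + 9) ℤ.* + suc n
  cleared = subst₂ ℤ._≤_ (trans (sym (ℤ.pos-* k (1 ℕ.* suc n ℕ.* 4))) (trans (cong +_ (left k (suc n))) (ℤ.pos-* (k ℕ.* 4) (suc n))))
    (right (+ suc n)) (ℚᵘ.drop-*≤* unnormalised)
    where
    left : ∀ k m → k ℕ.* (1 ℕ.* m ℕ.* 4) ≡ k ℕ.* 4 ℕ.* m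
    left = solve-∀
    right : ∀ i → (+ 1 ℤ.* i ℤ.+ (ℤ.- + 9) ℤ.* + 1) ℤ.* i ℤ.* + 1 ≡ (i ℤ.- + 9) ℤ.* i
    right = ℤSolver.solve-∀
  cancelled : + (k ℕ.* 4) ℤ.≤ + suc n ℤ.- + 9
  cancelled = ℤ.*-cancelʳ-≤-pos (+ (k ℕ.* 4)) (+ suc n ℤ.- + 9) (+ suc n) cleared
  plus-9 : ∀ i → i ℤ.- + 9 ℤ.+ + 9 ≡ i
  plus-9 = ℤSolver.solve-∀

theorem1 : Σ (ℕ → ℚ) λ ε → ((∀ (m : ℕ) → 0ℚ ≤ℚ ε m)
    × (∀ (δ : ℚ) → 0ℚ <ℚ δ → ∃[ M ] (∀ (m : ℕ) → M ≤ m → ε m ≤ℚ δ))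
    × (∀ (a b : ℕ) (D : Demand a b)
    → (∀ (x : Fin a) → (+ degA D x) / 1 ≤ℚ (1ℚ - ε b) * ((+ b) / 4))
    → (∀ (y : Fin b) → (+ degB D y) / 1 ≤ℚ (1ℚ - ε a) * ((+ a) / 4))
    → Resolvable D))
theorem1 = ε , 0≤ε , ε→0 , resolve
  where
  resolve : ∀ a b (D : Demand a b) → (∀ x → + degA D x / 1 ≤ℚ (1ℚ - ε b) * (+ b / 4)) →
    (∀ y → + degB D y / 1 ≤ℚ (1ℚ - ε a) * (+ a / 4)) → Resolvable D
  resolve a             b       []                 dA dB = (λ ()) , (λ ()) , λ ()
  -- The first demand supplies a vertex in each class, and the degree bounds at these two vertices
  -- force both classes to have at least 9 elements. Smaller classes occur only with no demands.
  resolve (suc a)       (suc b) D@((x , y) ∷ _)    dA dB = resolvable D bA bB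
    (≤-trans (m≤n+m 9 _) (bB y)) (≤-trans (m≤n+m 9 _) (bA x))
    where
    bA : ∀ u → degA D u ℕ.* 4 + 9 ≤ suc b
    bA u = degree-bound (degA D u) b (dA u)
    bB : ∀ v → degB D v ℕ.* 4 + 9 ≤ suc a
    bB v = degree-bound (degB D v) a (dB v)
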